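{- Consider the Online Interval Selection problem with revocable acceptances, on inputs that are simple chains, in the (any order) adversarial model. No deterministic algorithm with revoking can achieve an asymptotic competitive ratio better than $3/4$. That is, for every deterministic online algorithm $\mathrm{ALG}$ with revoking, if $\rho$ and $b$ are real numbers such that $\mathrm{ALG}(I)\ge \rho\cdot\mathrm{OPT}(I)-b$ for every finite simple chain $I$ presented in any arrival order, then $\rho\le 3/4$.
   Context: A simple chain of size $n$ is a set of $n$ unit-length intervals $I_1,\dots,I_n$ on the real line, numbered from left to right, such that $I_i$ and $I_j$ ($i\neq j$) overlap if and only if $|i-j|=1$ (the intersection graph is a path on $n$ vertices in this order). Online Interval Selection with revocable acceptances (unweighted): intervals (given by their endpoints) arrive one by one; on arrival of each interval a deterministic online algorithm, based only on the sequence of intervals that have arrived so far, either rejects it permanently or accepts it, and it may permanently revoke previously accepted intervals; rejected or revoked intervals can never be selected later. At all times the currently selected intervals must be pairwise non-overlapping. $\mathrm{ALG}(I)$ is the number of intervals selected at the end on the input sequence $I$, and $\mathrm{OPT}(I)$ is the maximum number of pairwise non-overlapping intervals in $I$. Adversarial (any order) model: the adversary chooses both the set of intervals and the order in which they arrive (arbitrary, not necessarily sorted). -}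

module Defs where

open import Data.Bool.Base using (Bool)
open import Data.Fin.Base as Fin using (Fin; toℕ)
open import Data.Fin.Permutation using (Permutation′; _⟨$⟩ʳ_)
open import Data.Fin.Subset using (Subset; _∈_; ∣_∣; _─_)
open import Data.Integer.Base using (+_)
open import Data.Nat.Base as ℕ using (ℕ; suc)
import Data.Nat.Properties as ℕ
open import Data.Product.Base using (∃-syntax; Σ-syntax; _×_; _,_)
open import Data.Rational.Base as ℚ using (ℚ; 0ℚ; 1ℚ; ½; 1/_; NonZero; Positive; positive)
import Data.Rational.Properties as ℚ
open import Data.Rational.Solver using (module +-*-Solver)
open import Data.Unit.Base using (⊤)
open import Data.Vec.Base using (Vec; []; _∷_; lookup)
open import Function.Bundles using (_⇔_)
open import Relation.Binary.PropositionalEquality using (_≡_; _≢_; refl; sym; trans; cong; cong₂; subst)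
open import Relation.Nullary.Negation using (¬_)

------------------------------------------------------------------------
-- Real numbers as Cauchy sequences of rationals, up to _≃_

record ℝ : Set where
  constructor mkℝ
  field
    seq    : ℕ → ℚ
    cauchy : ∀ ε → 0ℚ ℚ.< ε →
             ∃[ N ] ∀ m n → N ℕ.≤ m → N ℕ.≤ n → ℚ.∣ seq m ℚ.- seq n ∣ ℚ.< ε

open ℝ public

infix 4 _<_ _≤_ _≃_

_<_ : ℝ → ℝ → Set
x < y = ∃[ ε ] 0ℚ ℚ.< ε × ∃[ N ] ∀ n → N ℕ.≤ n → seq x n ℚ.+ ε ℚ.≤ seq y n

_≤_ : ℝ → ℝ → Set
x ≤ y = ¬ (y < x)

_≃_ : ℝ → ℝ → Set
x ≃ y = ∀ ε → 0ℚ ℚ.< ε →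
        ∃[ N ] ∀ n → N ℕ.≤ n → ℚ.∣ seq x n ℚ.- seq y n ∣ ℚ.< ε

private
  open ℚ.≤-Reasoning
  open +-*-Solver

  half-pos : ∀ {ε} → 0ℚ ℚ.< ε → 0ℚ ℚ.< ε ℚ.* ½
  half-pos {ε} p = ℚ.positive⁻¹ (ε ℚ.* ½) {{ℚ.pos*pos⇒pos ε {{positive p}} ½}}

  half+half : ∀ ε → ε ℚ.* ½ ℚ.+ ε ℚ.* ½ ≡ ε
  half+half ε = trans (sym (ℚ.*-distribˡ-+ ε ½ ½)) (ℚ.*-identityʳ ε)

  bound-pos : ∀ q → 0ℚ ℚ.< ℚ.∣ q ∣ ℚ.+ 1ℚ
  bound-pos q = ℚ.+-mono-≤-< (ℚ.0≤∣p∣ q) (ℚ.positive⁻¹ 1ℚ)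

fromℚ : ℚ → ℝ
fromℚ q = mkℝ (λ _ → q) λ ε 0<ε → 0 , λ _ _ _ _ →
  subst (ℚ._< ε) (sym (cong ℚ.∣_∣ (ℚ.+-inverseʳ q))) 0<ε

fromℕ : ℕ → ℝ
fromℕ n = fromℚ (+ n ℚ./ 1)

infixl 6 _+_ _-_
infixl 7 _*_
infix  8 -_

_+_ : ℝ → ℝ → ℝ
x + y = mkℝ (λ n → seq x n ℚ.+ seq y n) prf
  where
  prf : ∀ ε → 0ℚ ℚ.< ε → ∃[ N ] ∀ m n → N ℕ.≤ m → N ℕ.≤ n →
        ℚ.∣ (seq x m ℚ.+ seq y m) ℚ.- (seq x n ℚ.+ seq y n) ∣ ℚ.< ε
  prf ε 0<ε with cauchy x (ε ℚ.* ½) (half-pos 0<ε) | cauchy y (ε ℚ.* ½) (half-pos 0<ε)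
  ... | N , hx | M , hy = N ℕ.⊔ M , λ m n p q → begin-strict
    ℚ.∣ (seq x m ℚ.+ seq y m) ℚ.- (seq x n ℚ.+ seq y n) ∣
      ≡⟨ cong ℚ.∣_∣ (solve 4 (λ a b c d → (a :+ b) :- (c :+ d) := (a :- c) :+ (b :- d)) refl
           (seq x m) (seq y m) (seq x n) (seq y n)) ⟩
    ℚ.∣ (seq x m ℚ.- seq x n) ℚ.+ (seq y m ℚ.- seq y n) ∣
      ≤⟨ ℚ.∣p+q∣≤∣p∣+∣q∣ (seq x m ℚ.- seq x n) (seq y m ℚ.- seq y n) ⟩
    ℚ.∣ seq x m ℚ.- seq x n ∣ ℚ.+ ℚ.∣ seq y m ℚ.- seq y n ∣
      <⟨ ℚ.+-mono-< (hx m n (ℕ.m⊔n≤o⇒m≤o N M p) (ℕ.m⊔n≤o⇒m≤o N M q))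
                    (hy m n (ℕ.m⊔n≤o⇒n≤o N M p) (ℕ.m⊔n≤o⇒n≤o N M q)) ⟩
    ε ℚ.* ½ ℚ.+ ε ℚ.* ½
      ≡⟨ half+half ε ⟩
    ε ∎

-_ : ℝ → ℝ
- x = mkℝ (λ n → ℚ.- seq x n) prf
  where
  prf : ∀ ε → 0ℚ ℚ.< ε → ∃[ N ] ∀ m n → N ℕ.≤ m → N ℕ.≤ n →
        ℚ.∣ ℚ.- seq x m ℚ.- ℚ.- seq x n ∣ ℚ.< ε
  prf ε 0<ε with cauchy x ε 0<ε
  ... | N , h = N , λ m n p q → begin-strict
    ℚ.∣ ℚ.- seq x m ℚ.- ℚ.- seq x n ∣
      ≡⟨ cong ℚ.∣_∣ (solve 2 (λ a b → (:- a) :- (:- b) := b :- a) refl (seq x m) (seq x n)) ⟩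
    ℚ.∣ seq x n ℚ.- seq x m ∣
      <⟨ h n m q p ⟩
    ε ∎

_-_ : ℝ → ℝ → ℝ
x - y = x + - y

private
  eventually-bounded : ∀ x → ∃[ B ] 0ℚ ℚ.< B × ∃[ N ] ∀ n → N ℕ.≤ n → ℚ.∣ seq x n ∣ ℚ.≤ B
  eventually-bounded x with cauchy x 1ℚ (ℚ.positive⁻¹ 1ℚ)
  ... | N , h = ℚ.∣ seq x N ∣ ℚ.+ 1ℚ , bound-pos (seq x N) , N , λ n p → begin
    ℚ.∣ seq x n ∣
      ≡⟨ cong ℚ.∣_∣ (solve 2 (λ a b → a := b :+ (a :- b)) refl (seq x n) (seq x N)) ⟩
    ℚ.∣ seq x N ℚ.+ (seq x n ℚ.- seq x N) ∣
      ≤⟨ ℚ.∣p+q∣≤∣p∣+∣q∣ (seq x N) (seq x n ℚ.- seq x N) ⟩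
    ℚ.∣ seq x N ∣ ℚ.+ ℚ.∣ seq x n ℚ.- seq x N ∣
      ≤⟨ ℚ.+-monoʳ-≤ ℚ.∣ seq x N ∣ (ℚ.<⇒≤ (h n N p ℕ.≤-refl)) ⟩
    ℚ.∣ seq x N ∣ ℚ.+ 1ℚ ∎

  divide : ∀ ε B → 0ℚ ℚ.< ε → 0ℚ ℚ.< B → ∃[ δ ] 0ℚ ℚ.< δ × B ℚ.* δ ≡ ε
  divide ε B 0<ε 0<B =
    ε ℚ.* B⁻¹ , ℚ.positive⁻¹ (ε ℚ.* B⁻¹) {{ℚ.pos*pos⇒pos ε {{positive 0<ε}} B⁻¹ {{ℚ.1/pos⇒pos B}}}} , eq
    where
    instance
      B-pos : Positive B
      B-pos = positive 0<B
      B-nonZero : NonZero B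
      B-nonZero = ℚ.pos⇒nonZero B
    B⁻¹ : ℚ
    B⁻¹ = 1/ B
    eq : B ℚ.* (ε ℚ.* B⁻¹) ≡ ε
    eq = trans (solve 3 (λ b e c → b :* (e :* c) := e :* (b :* c)) refl B ε B⁻¹)
               (trans (cong (ε ℚ.*_) (ℚ.*-inverseʳ B)) (ℚ.*-identityʳ ε))

  difference-of-products : ∀ a b c d →
    a ℚ.* b ℚ.- c ℚ.* d ≡ a ℚ.* (b ℚ.- d) ℚ.+ d ℚ.* (a ℚ.- c)
  difference-of-products =
    solve 4 (λ a b c d → a :* b :- c :* d := a :* (b :- d) :+ d :* (a :- c)) refl

  *-bound : ∀ {p q B δ} → 0ℚ ℚ.< B → ℚ.∣ p ∣ ℚ.≤ B → ℚ.∣ q ∣ ℚ.< δ → ℚ.∣ p ℚ.* q ∣ ℚ.< B ℚ.* δ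
  *-bound {p} {q} {B} {δ} 0<B p≤B q<δ = begin-strict
    ℚ.∣ p ℚ.* q ∣           ≡⟨ ℚ.∣p*q∣≡∣p∣*∣q∣ p q ⟩
    ℚ.∣ p ∣ ℚ.* ℚ.∣ q ∣     ≤⟨ ℚ.*-monoʳ-≤-nonNeg ℚ.∣ q ∣ {{ℚ.∣-∣-nonNeg q}} p≤B ⟩
    B ℚ.* ℚ.∣ q ∣           <⟨ ℚ.*-monoʳ-<-pos B {{positive 0<B}} q<δ ⟩
    B ℚ.* δ                 ∎

  *-close : ∀ {a b c d A B α β} → 0ℚ ℚ.< A → 0ℚ ℚ.< B → ℚ.∣ a ∣ ℚ.≤ A → ℚ.∣ d ∣ ℚ.≤ B →
            ℚ.∣ b ℚ.- d ∣ ℚ.< α → ℚ.∣ a ℚ.- c ∣ ℚ.< β →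
            ℚ.∣ a ℚ.* b ℚ.- c ℚ.* d ∣ ℚ.< A ℚ.* α ℚ.+ B ℚ.* β
  *-close {a} {b} {c} {d} {A} {B} {α} {β} 0<A 0<B a≤A d≤B b-d<α a-c<β = begin-strict
    ℚ.∣ a ℚ.* b ℚ.- c ℚ.* d ∣
      ≡⟨ cong ℚ.∣_∣ (difference-of-products a b c d) ⟩
    ℚ.∣ a ℚ.* (b ℚ.- d) ℚ.+ d ℚ.* (a ℚ.- c) ∣
      ≤⟨ ℚ.∣p+q∣≤∣p∣+∣q∣ (a ℚ.* (b ℚ.- d)) (d ℚ.* (a ℚ.- c)) ⟩
    ℚ.∣ a ℚ.* (b ℚ.- d) ∣ ℚ.+ ℚ.∣ d ℚ.* (a ℚ.- c) ∣
      <⟨ ℚ.+-mono-< (*-bound {a} {b ℚ.- d} 0<A a≤A b-d<α) (*-bound {d} {a ℚ.- c} 0<B d≤B a-c<β) ⟩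
    A ℚ.* α ℚ.+ B ℚ.* β ∎

_*_ : ℝ → ℝ → ℝ
x * y = mkℝ (λ n → seq x n ℚ.* seq y n) prf
  where
  prf : ∀ ε → 0ℚ ℚ.< ε → ∃[ N ] ∀ m n → N ℕ.≤ m → N ℕ.≤ n →
        ℚ.∣ seq x m ℚ.* seq y m ℚ.- seq x n ℚ.* seq y n ∣ ℚ.< ε
  prf ε 0<ε =
    let A , 0<A , K , x≤A = eventually-bounded x
        B , 0<B , L , y≤B = eventually-bounded y
        α , 0<α , Aα≡ε/2  = divide (ε ℚ.* ½) A (half-pos 0<ε) 0<A
        β , 0<β , Bβ≡ε/2  = divide (ε ℚ.* ½) B (half-pos 0<ε) 0<B
        M , hx = cauchy x β 0<β
        N , hy = cauchy y α 0<α
    in (K ℕ.⊔ L) ℕ.⊔ (M ℕ.⊔ N) , λ m n p q →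
      let p₁ = ℕ.m⊔n≤o⇒m≤o (K ℕ.⊔ L) (M ℕ.⊔ N) p
          p₂ = ℕ.m⊔n≤o⇒n≤o (K ℕ.⊔ L) (M ℕ.⊔ N) p
          q₁ = ℕ.m⊔n≤o⇒m≤o (K ℕ.⊔ L) (M ℕ.⊔ N) q
          q₂ = ℕ.m⊔n≤o⇒n≤o (K ℕ.⊔ L) (M ℕ.⊔ N) q
      in subst (ℚ.∣ seq x m ℚ.* seq y m ℚ.- seq x n ℚ.* seq y n ∣ ℚ.<_)
           (trans (cong₂ ℚ._+_ Aα≡ε/2 Bβ≡ε/2) (half+half ε))
           (*-close {seq x m} {seq y m} {seq x n} {seq y n} 0<A 0<B
             (x≤A m (ℕ.m⊔n≤o⇒m≤o K L p₁)) (y≤B n (ℕ.m⊔n≤o⇒n≤o K L q₁))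
             (hy m n (ℕ.m⊔n≤o⇒n≤o M N p₂) (ℕ.m⊔n≤o⇒n≤o M N q₂))
             (hx m n (ℕ.m⊔n≤o⇒m≤o M N p₂) (ℕ.m⊔n≤o⇒m≤o M N q₂)))

------------------------------------------------------------------------
-- Intervals and simple chains

record Interval : Set where
  field
    left right    : ℝ
    .left<right   : left < right

open Interval public

UnitLength : Interval → Set
UnitLength I = right I ≃ left I + fromℕ 1

-- Intervals that merely share an endpoint do not overlap.
Overlap : Interval → Interval → Set
Overlap I J = left I < right J × left J < right I

record SimpleChain {n : ℕ} (I : Fin n → Interval) : Set where
  field
    unit          : ∀ i → UnitLength (I i)
    left-to-right : ∀ {i j} → i Fin.< j → left (I i) < left (I j)
    path          : ∀ {i j} → i ≢ j → Overlap (I i) (I j) ⇔ (ℕ.∣ toℕ i - toℕ j ∣ ≡ 1)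

-- A sequence of arrived intervals has the most recent arrival at its head,
-- so that its tail is the sequence seen one step earlier.
Arrivals : ℕ → Set
Arrivals = Vec Interval

-- The permutation sends the i-th interval from the left to its position in σ.
ChainInput : ∀ {n} → Arrivals n → Set
ChainInput {n} σ = Σ[ π ∈ Permutation′ n ] SimpleChain (λ i → lookup σ (π ⟨$⟩ʳ i))

------------------------------------------------------------------------
-- Online interval selection with revocable acceptances

NonOverlapping : ∀ {n} → Arrivals n → Subset n → Set
NonOverlapping σ S =
  ∀ {i j} → i ∈ S → j ∈ S → i ≢ j → ¬ Overlap (lookup σ i) (lookup σ j)

-- Both decisions are made on the arrival of the head of the sequence:
-- whether to accept it, and which of the earlier intervals to revoke.
record Strategy : Set where
  field
    accept : ∀ {n} → Arrivals (suc n) → Bool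
    revoke : ∀ {n} → Arrivals (suc n) → Subset n

  selected : ∀ {n} → Arrivals n → Subset n
  selected []      = []
  selected (I ∷ σ) = accept (I ∷ σ) ∷ (selected σ ─ revoke (I ∷ σ))

  FeasibleThroughout : ∀ {n} → Arrivals n → Set
  FeasibleThroughout []      = ⊤
  FeasibleThroughout (I ∷ σ) =
    NonOverlapping (I ∷ σ) (selected (I ∷ σ)) × FeasibleThroughout σ

-- Feasibility is demanded at every moment of every input of the problem,
-- the inputs being the simple chains in arbitrary order.
record Algorithm : Set where
  field
    strategy : Strategy

  open Strategy strategy public

  field
    feasible : ∀ {n} {σ : Arrivals n} → ChainInput σ → FeasibleThroughout σ

ALG : Algorithm → ∀ {n} → Arrivals n → ℕ
ALG alg σ = ∣ Algorithm.selected alg σ ∣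

-- k is the maximum size of a non-overlapping subset of σ.
IsOPT : ∀ {n} → Arrivals n → ℕ → Set
IsOPT {n} σ k =
  (∃[ S ] NonOverlapping σ S × ∣ S ∣ ≡ k) ×
  (∀ (S : Subset n) → NonOverlapping σ S → ∣ S ∣ ℕ.≤ k)

{-# OPTIONS --safe #-}

-- The adversary adds one pair of overlapping intervals p, q after another, each
-- to the left of everything so far, at a distance that still allows one or two
-- intervals in between.  After the arrival of a pair, q or p is lost for good,
-- according to whether p is accepted or not; this is the type of the pair.
-- If two consecutive pairs have the same type, the adversary puts one interval
-- between them, and otherwise two.  Deleting the lost intervals cuts the chain
-- into components.  A component of two intervals, which allows one selected
-- interval, accounts for three intervals if the types agree.  Where the type
-- changes, components of two and of four intervals alternate: eight intervals,
-- of which three are selected.  So ALG ≤ 3n/8 + O(1), while OPT ≥ n/2.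

module Submission where

open import Defs
open import Data.Bool.Base using (Bool; true; false; not; T; if_then_else_)
open import Data.Bool.Properties as Bool using (not-¬; not-involutive)
open import Data.Empty using (⊥)
open import Data.Fin.Base as Fin using (Fin; zero; suc; toℕ)
open import Data.Fin.Permutation
  using (Permutation′; _⟨$⟩ʳ_; _⟨$⟩ˡ_; inverseʳ; id; insert; lift₀)
import Data.Fin.Properties as Fin
open import Data.Fin.Subset using (Subset; _∈_; _⊆_; ∁; ∣_∣)
open import Data.Fin.Subset.Properties using (∣p∣≤n; ∣∁p∣≡n∸∣p∣; p─q⊆p; drop-there)
open import Data.Integer.Base as ℤ using (+_)
import Data.Integer.Properties as ℤ
open import Data.Nat.Base as ℕ using (ℕ; zero; suc; z≤n; s≤s)
import Data.Nat.Properties as ℕ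
open import Data.Nat.Solver using () renaming (module +-*-Solver to ℕ-Solver)
open import Data.Product.Base using (∃-syntax; _×_; _,_; proj₁; proj₂)
open import Data.Rational.Base as ℚ using (ℚ; 0ℚ; 1ℚ; _/_)
import Data.Rational.Properties as ℚ
open import Data.Rational.Solver using () renaming (module +-*-Solver to ℚ-Solver)
import Data.Rational.Unnormalised.Base as ℚᵘ
import Data.Rational.Unnormalised.Properties as ℚᵘ
open import Data.Sum.Base using (inj₁; inj₂; [_,_]′)
open import Data.Vec.Base using (Vec; []; _∷_; lookup; tabulate; here; there)
open import Data.Vec.Properties
  using ([]=⇒lookup; lookup⇒[]=; lookup-map; lookup∘tabulate)
open import Function.Base using (_∘_)
open import Function.Bundles using (_⇔_; mk⇔; module Equivalence)
open import Relation.Binary.Definitions using (tri<; tri≈; tri>)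
open import Relation.Binary.PropositionalEquality
open import Relation.Nullary.Decidable.Core using (yes; no)
open import Relation.Nullary.Negation using (¬_; contradiction)

-- Unit intervals at quarter-unit positions.

-- Positions are natural numbers of quarter units, growing leftwards, so that
-- the pair added last has the largest positions and heads the sorted chain.
leftEnd : ℕ → ℚ
leftEnd zero    = 0ℚ
leftEnd (suc z) = leftEnd z ℚ.- + 1 / 4

p-¼<p : ∀ p → p ℚ.- + 1 / 4 ℚ.< p
p-¼<p p = subst (p ℚ.- + 1 / 4 ℚ.<_) (ℚ.+-identityʳ p)
  (ℚ.+-monoʳ-< p (ℚ.negative⁻¹ (ℚ.- (+ 1 / 4))))

leftEnd-anti-≤ : ∀ {a b} → a ℕ.≤ b → leftEnd b ℚ.≤ leftEnd a
leftEnd-anti-≤ {a} {b} a≤b = go (ℕ.≤⇒≤′ a≤b)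
  where
  go : ∀ {c} → a ℕ.≤′ c → leftEnd c ℚ.≤ leftEnd a
  go ℕ.≤′-refl        = ℚ.≤-refl
  go (ℕ.≤′-step a≤′c) = ℚ.≤-trans (ℚ.<⇒≤ (p-¼<p _)) (go a≤′c)

leftEnd-anti-< : ∀ {a b} → a ℕ.< b → leftEnd b ℚ.< leftEnd a
leftEnd-anti-< {a} a<b = ℚ.≤-<-trans (leftEnd-anti-≤ a<b) (p-¼<p (leftEnd a))

-- Four quarter steps make one unit, so the intervals at `4 + a` and `a` only share an endpoint.
-- Overlap therefore means that the positions differ by at most three.
leftEnd-4+ : ∀ a → leftEnd (4 ℕ.+ a) ℚ.+ 1ℚ ≡ leftEnd a
leftEnd-4+ a = solve 1
  (λ p → p :- con (+ 1 / 4) :- con (+ 1 / 4) :- con (+ 1 / 4) :- con (+ 1 / 4) :+ con 1ℚ := p)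
  refl (leftEnd a)
  where open ℚ-Solver

-- Every endpoint used by the adversary is a constant Cauchy sequence, for which the order of the
-- reals reduces to that of the rationals.
Constant : ℝ → Set
Constant x = ∀ n → seq x n ≡ seq x 0

constant-< : ∀ x y → Constant x → Constant y → seq x 0 ℚ.< seq y 0 → x < y
constant-< x y x-const y-const p<q =
  q ℚ.- p , subst (ℚ._< q ℚ.- p) (ℚ.+-inverseʳ p) (ℚ.+-monoˡ-< (ℚ.- p) p<q) , 0 , λ n _ →
  ℚ.≤-reflexive (trans (cong (ℚ._+ (q ℚ.- p)) (x-const n))
    (trans (solve 2 (λ p q → p :+ (q :- p) := q) refl p q) (sym (y-const n))))
  where
  open ℚ-Solver
  p = seq x 0
  q = seq y 0

constant-<⁻¹ : ∀ x y → Constant x → Constant y → x < y → seq x 0 ℚ.< seq y 0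
constant-<⁻¹ x y x-const y-const (ε , 0<ε , N , h) = begin-strict
  seq x 0          ≡⟨ ℚ.+-identityʳ (seq x 0) ⟨
  seq x 0 ℚ.+ 0ℚ   <⟨ ℚ.+-monoʳ-< (seq x 0) 0<ε ⟩
  seq x 0 ℚ.+ ε    ≡⟨ cong (ℚ._+ ε) (x-const N) ⟨
  seq x N ℚ.+ ε    ≤⟨ h N ℕ.≤-refl ⟩
  seq y N          ≡⟨ y-const N ⟩
  seq y 0          ∎
  where open ℚ.≤-Reasoning

-- Opaque because the conversion checker would otherwise compare the Cauchy proofs inside.
opaque
  interval : ℕ → Interval
  interval z = record
    { left       = fromℚ (leftEnd z)
    ; right      = fromℚ (leftEnd z) + fromℕ 1
    ; left<right =
        constant-< (fromℚ (leftEnd z)) (fromℚ (leftEnd z) + fromℕ 1) (λ _ → refl) (λ _ → refl)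
          (subst (ℚ._< leftEnd z ℚ.+ 1ℚ) (ℚ.+-identityʳ _) (ℚ.+-monoʳ-< (leftEnd z) (ℚ.positive⁻¹ 1ℚ)))
    }

  left<right⇔ : ∀ a b → (left (interval a) < right (interval b)) ⇔ (b ℕ.< 4 ℕ.+ a)
  left<right⇔ a b = mk⇔
    (λ l<r → ℕ.≰⇒> λ 4+a≤b → ℚ.<-irrefl refl (ℚ.<-≤-trans
      (constant-<⁻¹ (left (interval a)) (right (interval b)) (λ _ → refl) (λ _ → refl) l<r)
      (subst (leftEnd b ℚ.+ 1ℚ ℚ.≤_) (leftEnd-4+ a) (ℚ.+-monoˡ-≤ 1ℚ (leftEnd-anti-≤ 4+a≤b)))))
    (λ b<4+a → constant-< (left (interval a)) (right (interval b)) (λ _ → refl) (λ _ → refl)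
      (subst (ℚ._< leftEnd b ℚ.+ 1ℚ) (leftEnd-4+ a) (ℚ.+-monoˡ-< 1ℚ (leftEnd-anti-< b<4+a))))

  interval-unit : ∀ z → UnitLength (interval z)
  interval-unit z ε 0<ε = 0 , λ n _ →
    subst (ℚ._< ε) (cong ℚ.∣_∣ (sym (ℚ.+-inverseʳ (leftEnd z ℚ.+ 1ℚ)))) 0<ε

  interval-left-< : ∀ {a b} → b ℕ.< a → left (interval a) < left (interval b)
  interval-left-< {a} {b} b<a =
    constant-< (left (interval a)) (left (interval b)) (λ _ → refl) (λ _ → refl) (leftEnd-anti-< b<a)

overlap⇔ : ∀ a b → Overlap (interval a) (interval b) ⇔ (b ℕ.< 4 ℕ.+ a × a ℕ.< 4 ℕ.+ b)
overlap⇔ a b = mk⇔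
  (λ (l , r) → Equivalence.to (left<right⇔ a b) l , Equivalence.to (left<right⇔ b a) r)
  (λ (l , r) → Equivalence.from (left<right⇔ a b) l , Equivalence.from (left<right⇔ b a) r)

-- Sorted positions that form a simple chain.

-- Only entries one or two apart are constrained; the rest follows by monotonicity. The bound
-- `4 + v ≤ z` is not strict, since touching intervals do not overlap.
data Chain : ∀ {n} → Vec ℕ n → Set where
  pair : ∀ {z w} → w ℕ.< z → z ℕ.< 4 ℕ.+ w → Chain (z ∷ w ∷ [])
  cons : ∀ {n z w v} {zs : Vec ℕ n} → w ℕ.< z → z ℕ.< 4 ℕ.+ w → 4 ℕ.+ v ℕ.≤ z →
         Chain (w ∷ v ∷ zs) → Chain (z ∷ w ∷ v ∷ zs)

head-max : ∀ {n z} {zs : Vec ℕ n} → Chain (z ∷ zs) → ∀ j → lookup zs j ℕ.< z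
head-max (pair w<z _)     zero    = w<z
head-max (cons w<z _ _ c) zero    = w<z
head-max (cons w<z _ _ c) (suc j) = ℕ.<-trans (head-max c j) w<z

decreasing : ∀ {n} {zs : Vec ℕ n} → Chain zs → ∀ {i j} → i Fin.< j → lookup zs j ℕ.< lookup zs i
decreasing {zs = _ ∷ _} c {zero}  {suc j} _         = head-max c j
decreasing (pair _ _)     {suc zero} {suc zero} (s≤s ())
decreasing (cons _ _ _ c) {suc i} {suc j} (s≤s i<j) = decreasing c i<j

neighbour-close : ∀ {n} {zs : Vec ℕ n} → Chain zs → ∀ {i j} → toℕ j ≡ suc (toℕ i) →
                  lookup zs i ℕ.< 4 ℕ.+ lookup zs j
neighbour-close (pair _ z<4+w)     {zero}  {suc zero} _  = z<4+w
neighbour-close (pair _ _)         {suc zero} {suc zero} ()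
neighbour-close (cons _ z<4+w _ _) {zero}  {suc zero} _  = z<4+w
neighbour-close (cons _ _ _ c)     {suc i} {suc j}    eq = neighbour-close c (ℕ.suc-injective eq)

others-far : ∀ {n} {zs : Vec ℕ n} → Chain zs → ∀ {i j} → suc (toℕ i) ℕ.< toℕ j →
             4 ℕ.+ lookup zs j ℕ.≤ lookup zs i
others-far (pair _ _) {_} {suc zero} (s≤s ())
others-far (cons _ _ _ _)     {zero} {suc zero} (s≤s ())
others-far (cons _ _ 4+v≤z _) {zero} {suc (suc zero)}    _ = 4+v≤z
-- Everything beyond the third entry lies further right than `v`, which is already far enough from
-- `z`.
others-far (cons {z = z} {v = v} _ _ 4+v≤z c) {zero} {suc (suc (suc j))} _ =
  ℕ.≤-trans (ℕ.+-monoʳ-≤ 4 (ℕ.<⇒≤ (decreasing c (s≤s (s≤s z≤n))))) 4+v≤z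
others-far (cons _ _ _ c) {suc i} {suc j} (s≤s i<j) = others-far c i<j

chain-path : ∀ {n} {zs : Vec ℕ n} → Chain zs → ∀ {i j} → i ≢ j →
             Overlap (interval (lookup zs i)) (interval (lookup zs j)) ⇔ (ℕ.∣ toℕ i - toℕ j ∣ ≡ 1)
chain-path {zs = zs} c {i} {j} i≢j = mk⇔ (to i≢j ∘ Equivalence.to (overlap⇔ _ _))
                                          (Equivalence.from (overlap⇔ _ _) ∘ from)
  where
  Close : ℕ → ℕ → Set
  Close a b = b ℕ.< 4 ℕ.+ a × a ℕ.< 4 ℕ.+ b

  swap : ∀ {a b} → Close a b → Close b a
  swap (p , q) = q , p

  to< : ∀ {i j} → i Fin.< j → Close (lookup zs i) (lookup zs j) → ℕ.∣ toℕ i - toℕ j ∣ ≡ 1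
  to< {i} {j} i<j (_ , near) with ℕ.m≤n⇒m<n∨m≡n i<j
  ... | inj₁ 1+i<j = contradiction (ℕ.<-≤-trans near (others-far c 1+i<j)) (ℕ.<-irrefl refl)
  ... | inj₂ 1+i≡j = trans (ℕ.m≤n⇒∣m-n∣≡n∸m (ℕ.<⇒≤ i<j))
                       (trans (cong (ℕ._∸ toℕ i) (sym 1+i≡j)) (ℕ.m+n∸n≡m 1 (toℕ i)))

  to : ∀ {i j} → i ≢ j → Close (lookup zs i) (lookup zs j) → ℕ.∣ toℕ i - toℕ j ∣ ≡ 1
  to {i} {j} i≢j close with Fin.<-cmp i j
  ... | tri< i<j _ _ = to< i<j close
  ... | tri≈ _ i≡j _ = contradiction i≡j i≢j
  ... | tri> _ _ j<i = trans (ℕ.∣-∣-comm (toℕ i) (toℕ j)) (to< j<i (swap close))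

  from< : ∀ {i j} → i Fin.< j → ℕ.∣ toℕ i - toℕ j ∣ ≡ 1 → Close (lookup zs i) (lookup zs j)
  from< {i} {j} i<j eq =
    ℕ.<-≤-trans (decreasing c i<j) (ℕ.m≤n+m _ 4) ,
    neighbour-close c (trans (sym (ℕ.m∸n+n≡m (ℕ.<⇒≤ i<j)))
      (cong (ℕ._+ toℕ i) (trans (sym (ℕ.m≤n⇒∣m-n∣≡n∸m (ℕ.<⇒≤ i<j))) eq)))

  from : ℕ.∣ toℕ i - toℕ j ∣ ≡ 1 → Close (lookup zs i) (lookup zs j)
  from eq with Fin.<-cmp i j
  ... | tri< i<j _ _ = from< i<j eq
  ... | tri≈ _ i≡j _ = contradiction i≡j i≢j
  ... | tri> _ _ j<i = swap (from< j<i (trans (ℕ.∣-∣-comm (toℕ j) (toℕ i)) eq))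

-- Arrival order versus left-to-right order.

-- Separates the geometry, held by `zs` from left to right, from the history `σ`, held with the
-- latest arrival first.
record Arrangement {n} (σ : Arrivals n) (zs : Vec ℕ n) : Set where
  field
    perm   : Permutation′ n
    sorted : ∀ i → lookup σ (perm ⟨$⟩ʳ i) ≡ interval (lookup zs i)

open Arrangement

arrange-leftmost : ∀ {n} {σ : Arrivals n} {zs} z → Arrangement σ zs → Arrangement (interval z ∷ σ) (z ∷ zs)
arrange-leftmost z arr = record
  { perm   = lift₀ (perm arr)
  ; sorted = λ { zero → refl ; (suc i) → sorted arr i }
  }

-- The latest arrival, index zero of the history, is placed just to the right of the leftmost pair,
-- at sorted index two.
arrange-third : ∀ {n} {σ : Arrivals (2 ℕ.+ n)} {p q zs} x → Arrangement σ (p ∷ q ∷ zs) →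
                Arrangement (interval x ∷ σ) (p ∷ q ∷ x ∷ zs)
arrange-third x arr = record
  { perm   = insert (suc (suc zero)) zero (perm arr)
  ; sorted = λ { zero → sorted arr zero ; (suc zero) → sorted arr (suc zero) ; (suc (suc zero)) → refl
               ; (suc (suc (suc i))) → sorted arr (suc (suc i)) }
  }

chain-input : ∀ {n} {σ : Arrivals n} {zs} → Arrangement σ zs → Chain zs → ChainInput σ
chain-input {σ = σ} {zs} arr c = perm arr , record
  { unit          = λ i → subst UnitLength (sym (sorted arr i)) (interval-unit (lookup zs i))
  ; left-to-right = λ {i} {j} i<j → subst₂ (λ I J → left I < left J)
      (sym (sorted arr i)) (sym (sorted arr j)) (interval-left-< (decreasing c i<j))
  ; path          = λ {i} {j} i≢j → subst₂ (λ I J → Overlap I J ⇔ (ℕ.∣ toℕ i - toℕ j ∣ ≡ 1))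
      (sym (sorted arr i)) (sym (sorted arr j)) (chain-path c i≢j)
  }

-- Existence of the optimum and its lower bound by half the intervals.

even : ℕ → Bool
even zero    = true
even (suc n) = not (even n)

even-neighbour : ∀ a b → ℕ.∣ a - b ∣ ≡ 1 → even a ≡ not (even b)
even-neighbour zero       (suc b) refl = refl
even-neighbour (suc zero) zero    _    = refl
even-neighbour (suc a)    (suc b) eq   = cong not (even-neighbour a b eq)

-- Overlapping intervals are neighbours on the path, so their left-to-right indices have opposite
-- parity.
parity-class-NonOverlapping : ∀ {n} (σ : Arrivals n) (input : ChainInput σ) {S : Subset n} {b} →
  (∀ {i} → i ∈ S → even (toℕ (proj₁ input ⟨$⟩ˡ i)) ≡ b) → NonOverlapping σ S
parity-class-NonOverlapping σ (π , chain) parity {i} {j} i∈S j∈S i≢j I∩J =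
  not-¬ (trans (parity i∈S) (sym (parity j∈S)))
    (even-neighbour (toℕ (π ⟨$⟩ˡ i)) (toℕ (π ⟨$⟩ˡ j)) neighbours)
  where
  neighbours : ℕ.∣ toℕ (π ⟨$⟩ˡ i) - toℕ (π ⟨$⟩ˡ j) ∣ ≡ 1
  neighbours = Equivalence.to
    (SimpleChain.path chain λ eq →
      i≢j (trans (sym (inverseʳ π)) (trans (cong (π ⟨$⟩ʳ_) eq) (inverseʳ π))))
    (subst₂ (λ i j → Overlap (lookup σ i) (lookup σ j)) (sym (inverseʳ π)) (sym (inverseʳ π)) I∩J)

-- The even and the odd indices split the chain into two independent sets, and the larger one has at
-- least half of the intervals.
half-NonOverlapping : ∀ {n} (σ : Arrivals n) → ChainInput σ → ∃[ S ] NonOverlapping σ S × n ℕ.≤ 2 ℕ.* ∣ S ∣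
half-NonOverlapping {n} σ input@(π , _) = [ big-∁ , big ]′ (ℕ.≤-total ∣ evens ∣ ∣ ∁ evens ∣)
  where
  evens : Subset n
  evens = tabulate λ i → even (toℕ (π ⟨$⟩ˡ i))

  n≡ : n ≡ ∣ evens ∣ ℕ.+ ∣ ∁ evens ∣
  n≡ = sym (trans (cong (∣ evens ∣ ℕ.+_) (∣∁p∣≡n∸∣p∣ evens)) (ℕ.m+[n∸m]≡n (∣p∣≤n evens)))

  ∁-parity : ∀ {i} → i ∈ ∁ evens → even (toℕ (π ⟨$⟩ˡ i)) ≡ false
  ∁-parity {i} i∈∁ = trans (sym (not-involutive _)) (cong not
    (trans (cong not (sym (lookup∘tabulate _ i))) (trans (sym (lookup-map i not evens)) ([]=⇒lookup i∈∁))))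

  parity : ∀ {i} → i ∈ evens → even (toℕ (π ⟨$⟩ˡ i)) ≡ true
  parity {i} i∈ = trans (sym (lookup∘tabulate _ i)) ([]=⇒lookup i∈)

  double : ∀ m → m ℕ.+ m ≡ 2 ℕ.* m
  double m = cong (m ℕ.+_) (sym (ℕ.+-identityʳ m))

  big-∁ : ∣ evens ∣ ℕ.≤ ∣ ∁ evens ∣ → ∃[ S ] NonOverlapping σ S × n ℕ.≤ 2 ℕ.* ∣ S ∣
  big-∁ le = ∁ evens , parity-class-NonOverlapping σ input ∁-parity ,
    ℕ.≤-trans (ℕ.≤-reflexive n≡)
      (ℕ.≤-trans (ℕ.+-monoˡ-≤ ∣ ∁ evens ∣ le) (ℕ.≤-reflexive (double ∣ ∁ evens ∣)))

  big : ∣ ∁ evens ∣ ℕ.≤ ∣ evens ∣ → ∃[ S ] NonOverlapping σ S × n ℕ.≤ 2 ℕ.* ∣ S ∣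
  big le = evens , parity-class-NonOverlapping σ input parity ,
    ℕ.≤-trans (ℕ.≤-reflexive n≡)
      (ℕ.≤-trans (ℕ.+-monoʳ-≤ ∣ evens ∣ le) (ℕ.≤-reflexive (double ∣ evens ∣)))

-- Constructively, overlap of real intervals is undecidable.
¬¬-optimum : ∀ {n} (σ : Arrivals n) S → NonOverlapping σ S → ¬ ¬ (∃[ k ] IsOPT σ k)
¬¬-optimum {n} σ S₀ S₀-ok none = go n S₀ S₀-ok (ℕ.m≤m+n n ∣ S₀ ∣)
  where
  -- The fuel `d` bounds by how much any set can exceed `S`. A larger non-overlapping set would
  -- replace `S` at the cost of one unit of fuel.
  go : ∀ d S → NonOverlapping σ S → n ℕ.≤ d ℕ.+ ∣ S ∣ → ⊥
  go d S ok n≤ = none (∣ S ∣ , (S , ok , refl) , maximal d n≤)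
    where
    maximal : ∀ d → n ℕ.≤ d ℕ.+ ∣ S ∣ → ∀ S′ → NonOverlapping σ S′ → ∣ S′ ∣ ℕ.≤ ∣ S ∣
    maximal zero    n≤ S′ _  = ℕ.≤-trans (∣p∣≤n S′) n≤
    maximal (suc d) n≤ S′ ok′ with ∣ S′ ∣ ℕ.≤? ∣ S ∣
    ... | yes S′≤S = S′≤S
    ... | no  S′≰S = contradiction
      (ℕ.≤-trans n≤ (ℕ.≤-trans (ℕ.≤-reflexive (sym (ℕ.+-suc d ∣ S ∣)))
        (ℕ.+-monoʳ-≤ d (ℕ.≰⇒> S′≰S))))
      (go d S′ ok′)

-- Amortised cost of a pair and its connecting intervals.

bit : Bool → ℕ
bit b = if b then 1 else 0

bit≤1 : ∀ b → bit b ℕ.≤ 1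
bit≤1 false = z≤n
bit≤1 true  = s≤s z≤n

∣∷∣ : ∀ {n} s (S : Subset n) → ∣ s ∷ S ∣ ≡ bit s ℕ.+ ∣ S ∣
∣∷∣ false S = refl
∣∷∣ true  S = refl

at-most-one : ∀ {n} (σ : Arrivals n) {S} → NonOverlapping σ S → ∀ {i j} → i ≢ j →
              Overlap (lookup σ i) (lookup σ j) → bit (lookup S i) ℕ.+ bit (lookup S j) ℕ.≤ 1
at-most-one σ {S} ok {i} {j} i≢j I∩J with lookup S i in i∈S | lookup S j in j∈S
... | false | s     = bit≤1 s
... | true  | false = s≤s z≤n
... | true  | true  = contradiction I∩J (ok (lookup⇒[]= i S i∈S) (lookup⇒[]= j S j∈S) i≢j)

-- Of the two members of the leftmost pair, the one that can no longer be selected.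
Lost : Bool → ℕ → ℕ → Set
Lost true  p q = q ≡ 0
Lost false p q = p ≡ 0

-- Amortises the alternation of large and small components; p tells whether the
-- interval p of the leftmost pair is selected, as its component is still open.
penalty : Bool → ℕ → ℕ
penalty true  p = 8 ℕ.* p
penalty false p = 4

-- The order from left to right is `p`, `q`, `x`, `p₀`. The three new intervals have budget 9, three
-- eighths each. The component closed is `x`, `p₀` for type `true` and `q`, `x` for type `false`; it
-- contributes at most 8.
same-type-cost : ∀ t {p₀ x p q} → x ℕ.+ p₀ ℕ.≤ 1 → q ℕ.+ x ℕ.≤ 1 → Lost t p q →
  penalty t p₀ ℕ.+ 8 ℕ.* (x ℕ.+ (p ℕ.+ q)) ℕ.≤ 9 ℕ.+ penalty t p
same-type-cost true {p₀} {x} {p} x+p₀≤1 _ refl = begin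
  8 ℕ.* p₀ ℕ.+ 8 ℕ.* (x ℕ.+ (p ℕ.+ 0))
    ≡⟨ solve 3 (λ p₀ x p → con 8 :* p₀ :+ con 8 :* (x :+ (p :+ con 0)) :=
                           con 8 :* (x :+ p₀) :+ con 8 :* p) refl p₀ x p ⟩
  8 ℕ.* (x ℕ.+ p₀) ℕ.+ 8 ℕ.* p
    ≤⟨ ℕ.+-monoˡ-≤ (8 ℕ.* p) (ℕ.≤-trans (ℕ.*-monoʳ-≤ 8 x+p₀≤1) (ℕ.n≤1+n 8)) ⟩
  9 ℕ.+ 8 ℕ.* p ∎
  where open ℕ.≤-Reasoning; open ℕ-Solver
same-type-cost false {p₀} {x} {q = q} _ q+x≤1 refl = begin
  4 ℕ.+ 8 ℕ.* (x ℕ.+ q)    ≡⟨ cong (λ m → 4 ℕ.+ 8 ℕ.* m) (ℕ.+-comm x q) ⟩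
  4 ℕ.+ 8 ℕ.* (q ℕ.+ x)    ≤⟨ ℕ.+-monoʳ-≤ 4 (ℕ.*-monoʳ-≤ 8 q+x≤1) ⟩
  12                       ≤⟨ ℕ.n≤1+n 12 ⟩
  13                       ∎
  where open ℕ.≤-Reasoning

-- The order is `p`, `q`, `x`, `y`, `p₀`, and the budget is 12. From `true` to `false` the component
-- `q`, `x`, `y`, `p₀` may cost 16, and the excess of 4 becomes the penalty. From `false` to `true`
-- the component `x`, `y` costs at most 8, which repays it.
changed-type-cost : ∀ t {p₀ x y p q} → y ℕ.+ p₀ ℕ.≤ 1 → x ℕ.+ y ℕ.≤ 1 → q ℕ.+ x ℕ.≤ 1 → Lost (not t) p q →
  penalty t p₀ ℕ.+ 8 ℕ.* (x ℕ.+ (y ℕ.+ (p ℕ.+ q))) ℕ.≤ 12 ℕ.+ penalty (not t) p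
changed-type-cost true {p₀} {x} {y} {q = q} y+p₀≤1 _ q+x≤1 refl = begin
  8 ℕ.* p₀ ℕ.+ 8 ℕ.* (x ℕ.+ (y ℕ.+ q))
    ≡⟨ solve 4 (λ p₀ x y q → con 8 :* p₀ :+ con 8 :* (x :+ (y :+ q)) :=
                             con 8 :* ((y :+ p₀) :+ (q :+ x))) refl p₀ x y q ⟩
  8 ℕ.* ((y ℕ.+ p₀) ℕ.+ (q ℕ.+ x))
    ≤⟨ ℕ.*-monoʳ-≤ 8 (ℕ.+-mono-≤ y+p₀≤1 q+x≤1) ⟩
  16 ∎
  where open ℕ.≤-Reasoning; open ℕ-Solver
changed-type-cost false {p₀} {x} {y} {p} _ x+y≤1 _ refl = begin
  4 ℕ.+ 8 ℕ.* (x ℕ.+ (y ℕ.+ (p ℕ.+ 0)))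
    ≡⟨ solve 3 (λ x y p → con 4 :+ con 8 :* (x :+ (y :+ (p :+ con 0))) :=
                          con 4 :+ con 8 :* (x :+ y) :+ con 8 :* p) refl x y p ⟩
  4 ℕ.+ 8 ℕ.* (x ℕ.+ y) ℕ.+ 8 ℕ.* p
    ≤⟨ ℕ.+-monoˡ-≤ (8 ℕ.* p) (ℕ.+-monoʳ-≤ 4 (ℕ.*-monoʳ-≤ 8 x+y≤1)) ⟩
  12 ℕ.+ 8 ℕ.* p ∎
  where open ℕ.≤-Reasoning; open ℕ-Solver

add-cost : ∀ {s B u a k} → 8 ℕ.* s ℕ.≤ B ℕ.+ a → a ℕ.+ 8 ℕ.* u ℕ.≤ k → 8 ℕ.* (u ℕ.+ s) ℕ.≤ B ℕ.+ k
add-cost {s} {B} {u} {a} {k} 8s≤B+a a+8u≤k = begin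
  8 ℕ.* (u ℕ.+ s)             ≡⟨ solve 2 (λ u s → con 8 :* (u :+ s) := con 8 :* s :+ con 8 :* u) refl u s ⟩
  8 ℕ.* s ℕ.+ 8 ℕ.* u         ≤⟨ ℕ.+-monoˡ-≤ (8 ℕ.* u) 8s≤B+a ⟩
  B ℕ.+ a ℕ.+ 8 ℕ.* u         ≡⟨ ℕ.+-assoc B a (8 ℕ.* u) ⟩
  B ℕ.+ (a ℕ.+ 8 ℕ.* u)       ≤⟨ ℕ.+-monoʳ-≤ B a+8u≤k ⟩
  B ℕ.+ k                     ∎
  where open ℕ.≤-Reasoning; open ℕ-Solver

-- For numerals the implicit argument computes to the unit type and is inferred, so all distances in
-- the construction are checked by evaluation.
shift-≤ : ∀ c d b {c≤d : T (c ℕ.≤ᵇ d)} → c ℕ.+ b ℕ.≤ d ℕ.+ b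
shift-≤ c d b {c≤d} = ℕ.+-monoˡ-≤ b (ℕ.≤ᵇ⇒≤ c d c≤d)

shifted-overlap : ∀ c d b {d<4+c : T (suc d ℕ.≤ᵇ 4 ℕ.+ c)} {c<4+d : T (suc c ℕ.≤ᵇ 4 ℕ.+ d)} →
                  Overlap (interval (c ℕ.+ b)) (interval (d ℕ.+ b))
shifted-overlap c d b {d<4+c} {c<4+d} = Equivalence.from (overlap⇔ (c ℕ.+ b) (d ℕ.+ b))
  (shift-≤ (suc d) (4 ℕ.+ c) b {d<4+c} , shift-≤ (suc c) (4 ℕ.+ d) b {c<4+d})

shifted-cons : ∀ z w v b {n} {zs : Vec ℕ n} {w<z : T (suc w ℕ.≤ᵇ z)} {z<4+w : T (suc z ℕ.≤ᵇ 4 ℕ.+ w)}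
               {4+v≤z : T (4 ℕ.+ v ℕ.≤ᵇ z)} →
               Chain (w ℕ.+ b ∷ v ℕ.+ b ∷ zs) → Chain (z ℕ.+ b ∷ w ℕ.+ b ∷ v ℕ.+ b ∷ zs)
shifted-cons z w v b {w<z = w<z} {z<4+w} {4+v≤z} = cons
  (shift-≤ (suc w) z b {w<z}) (shift-≤ (suc z) (4 ℕ.+ w) b {z<4+w}) (shift-≤ (4 ℕ.+ v) z b {4+v≤z})

-- The adversary's strategy.

module Adversary (alg : Algorithm) where
  open Algorithm alg

  -- Rejections and revocations are permanent, so whatever is selected now was already selected
  -- before the latest arrival.
  restrict : ∀ {n} {σ : Arrivals n} {S I s} → (s ∷ S) ⊆ selected (I ∷ σ) → S ⊆ selected σ
  restrict {σ = σ} {I = I} S⊆ i∈S = p─q⊆p (selected σ) (revoke (I ∷ σ)) (drop-there (S⊆ (there i∈S)))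

  subset-NonOverlapping : ∀ {n} {σ : Arrivals n} {S} → NonOverlapping σ (selected σ) → S ⊆ selected σ →
                          NonOverlapping σ S
  subset-NonOverlapping ok S⊆ i∈S j∈S = ok (S⊆ i∈S) (S⊆ j∈S)

  -- If `I` is accepted, feasibility excludes the overlapping `J`; otherwise `I` itself is out. With
  -- `restrict`, this also constrains every later selection.
  lost : ∀ {n} {σ : Arrivals n} {I J s t S} → NonOverlapping (I ∷ J ∷ σ) (selected (I ∷ J ∷ σ)) →
         Overlap I J → (s ∷ t ∷ S) ⊆ selected (I ∷ J ∷ σ) → Lost (accept (I ∷ J ∷ σ)) (bit s) (bit t)
  lost {σ = σ} {I} {J} {s} {t} ok I∩J S⊆ with accept (I ∷ J ∷ σ) in eq
  lost {t = false} ok I∩J S⊆ | true  = refl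
  lost {t = true}  ok I∩J S⊆ | true  = contradiction I∩J (ok here (S⊆ (there here)) λ ())
  lost {s = false} ok I∩J S⊆ | false = refl
  lost {s = true}  ok I∩J S⊆ | false with () ← S⊆ here

  -- The bound covers all subsets of the current selection because later revocations may leave any
  -- of them. The penalty refers to the leftmost interval of that same subset. The size bound makes
  -- the optimum grow with `m`.
  record Stage (m : ℕ) : Set where
    field
      {n}          : ℕ
      {σ}          : Arrivals (2 ℕ.+ n)
      base         : ℕ
      {rest}       : Vec ℕ n
      arrangement  : Arrangement σ (2 ℕ.+ base ∷ base ∷ rest)
      chain        : Chain (2 ℕ.+ base ∷ base ∷ rest)
      leftAccepted : Bool
      bound        : ∀ S → S ⊆ selected σ → 8 ℕ.* ∣ S ∣ ℕ.≤
        3 ℕ.* (2 ℕ.+ n) ℕ.+ penalty leftAccepted (bit (lookup S (perm arrangement ⟨$⟩ʳ zero)))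
      size         : 2 ℕ.* m ℕ.≤ 2 ℕ.+ n

    input : ChainInput σ
    input = chain-input arrangement chain

  first-stage : Stage 0
  first-stage = record
    { base         = 0
    ; arrangement  = arr
    ; chain        = c
    ; leftAccepted = accept σ
    ; bound        = λ { (p ∷ q ∷ []) S⊆ → subst (λ k → 8 ℕ.* k ℕ.≤ 6 ℕ.+ penalty (accept σ) (bit p))
                       (sym (trans (∣∷∣ p (q ∷ [])) (cong (bit p ℕ.+_) (∣∷∣ q []))))
                       (cost (accept σ) q (lost ok (shifted-overlap 2 0 0) S⊆)) }
    ; size         = z≤n
    }
    where
    σ : Arrivals 2
    σ = interval 2 ∷ interval 0 ∷ []
    c : Chain (2 ∷ 0 ∷ [])
    c = pair (shift-≤ 1 2 0) (shift-≤ 3 4 0)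
    arr : Arrangement σ (2 ∷ 0 ∷ [])
    arr = arrange-leftmost 2 (arrange-leftmost 0 (record { perm = id ; sorted = λ () }))
    ok : NonOverlapping σ (selected σ)
    ok = proj₁ (feasible (chain-input arr c))
    cost : ∀ t {p} q → Lost t p (bit q) → 8 ℕ.* (p ℕ.+ (bit q ℕ.+ 0)) ℕ.≤ 6 ℕ.+ penalty t p
    cost true  {p} false _    = ℕ.≤-trans (ℕ.≤-reflexive (cong (8 ℕ.*_) (ℕ.+-identityʳ p))) (ℕ.m≤n+m _ 6)
    cost false     false refl = z≤n
    cost false     true  refl = ℕ.m≤m+n 8 2

  module NextStage {m} (stage : Stage m) where
    open Stage stage renaming (base to b)

    -- The gap between `2 + b` and `8 + b` admits either one interval at `5 + b` or two at `4 + b`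
    -- and `6 + b`, so the adversary can choose after seeing the decision on the new pair.
    τ : Arrivals (4 ℕ.+ n)
    τ = interval (10 ℕ.+ b) ∷ interval (8 ℕ.+ b) ∷ σ

    τ-arrangement : Arrangement τ (10 ℕ.+ b ∷ 8 ℕ.+ b ∷ 2 ℕ.+ b ∷ b ∷ rest)
    τ-arrangement = arrange-leftmost (10 ℕ.+ b) (arrange-leftmost (8 ℕ.+ b) arrangement)

    leftmost : Fin (2 ℕ.+ n)
    leftmost = perm arrangement ⟨$⟩ʳ zero

    size-suc : 2 ℕ.* suc m ℕ.≤ 4 ℕ.+ n
    size-suc = ℕ.≤-trans (ℕ.≤-reflexive (ℕ.*-suc 2 m)) (ℕ.+-monoʳ-≤ 2 size)

    same-type : accept τ ≡ leftAccepted → Stage (suc m)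
    same-type same = record
      { base         = 8 ℕ.+ b
      ; arrangement  = arrangement₁
      ; chain        = chain₁
      ; leftAccepted = leftAccepted
      ; bound        = bound₁
      ; size         = ℕ.≤-trans size-suc (ℕ.n≤1+n (4 ℕ.+ n))
      }
      where
      σ₁ : Arrivals (5 ℕ.+ n)
      σ₁ = interval (5 ℕ.+ b) ∷ τ

      arrangement₁ : Arrangement σ₁ (10 ℕ.+ b ∷ 8 ℕ.+ b ∷ 5 ℕ.+ b ∷ 2 ℕ.+ b ∷ b ∷ rest)
      arrangement₁ = arrange-third (5 ℕ.+ b) τ-arrangement

      chain₁ : Chain (10 ℕ.+ b ∷ 8 ℕ.+ b ∷ 5 ℕ.+ b ∷ 2 ℕ.+ b ∷ b ∷ rest)
      chain₁ = shifted-cons 10 8 5 b (shifted-cons 8 5 2 b (shifted-cons 5 2 0 b chain))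

      -- Feasibility is granted only on chains, and `τ` still has a gap. It is obtained for `τ` as
      -- an earlier moment of the completed chain.
      ok : FeasibleThroughout σ₁
      ok = feasible (chain-input arrangement₁ chain₁)

      bound₁ : ∀ S → S ⊆ selected σ₁ →
        8 ℕ.* ∣ S ∣ ℕ.≤ 3 ℕ.* (5 ℕ.+ n) ℕ.+ penalty leftAccepted (bit (lookup S (suc zero)))
      bound₁ (x ∷ p ∷ q ∷ S) S⊆ = begin
        8 ℕ.* ∣ x ∷ p ∷ q ∷ S ∣
          ≡⟨ cong (8 ℕ.*_) count ⟩
        8 ℕ.* ((bit x ℕ.+ (bit p ℕ.+ bit q)) ℕ.+ ∣ S ∣)
          ≤⟨ add-cost {∣ S ∣} {3 ℕ.* (2 ℕ.+ n)} {bit x ℕ.+ (bit p ℕ.+ bit q)}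
                 (bound S (restrict (restrict (restrict S⊆))))
               (same-type-cost leftAccepted
                 -- The old leftmost interval is now three arrivals further back in the history.
                 (at-most-one σ₁ S-ok {zero} {suc (suc (suc leftmost))} (λ ())
                   (subst (Overlap (interval (5 ℕ.+ b))) (sym (sorted arrangement zero))
                     (shifted-overlap 5 2 b)))
                 (at-most-one σ₁ S-ok {suc (suc zero)} {zero} (λ ()) (shifted-overlap 8 5 b))
                 (subst (λ t → Lost t (bit p) (bit q)) same
                   (lost (proj₁ (proj₂ ok)) (shifted-overlap 10 8 b) (restrict S⊆)))) ⟩
        3 ℕ.* (2 ℕ.+ n) ℕ.+ (9 ℕ.+ penalty leftAccepted (bit p))
          ≡⟨ solve 2 (λ n k → con 3 :* (con 2 :+ n) :+ (con 9 :+ k) := con 3 :* (con 5 :+ n) :+ k)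
               refl n (penalty leftAccepted (bit p)) ⟩
        3 ℕ.* (5 ℕ.+ n) ℕ.+ penalty leftAccepted (bit p) ∎
        where
        open ℕ.≤-Reasoning
        open ℕ-Solver
        S-ok : NonOverlapping σ₁ (x ∷ p ∷ q ∷ S)
        S-ok = subset-NonOverlapping (proj₁ ok) S⊆
        count : ∣ x ∷ p ∷ q ∷ S ∣ ≡ (bit x ℕ.+ (bit p ℕ.+ bit q)) ℕ.+ ∣ S ∣
        count rewrite ∣∷∣ x (p ∷ q ∷ S) | ∣∷∣ p (q ∷ S) | ∣∷∣ q S =
          solve 4 (λ x p q s → x :+ (p :+ (q :+ s)) := (x :+ (p :+ q)) :+ s) refl (bit x) (bit p) (bit q) ∣ S ∣

    changed-type : accept τ ≡ not leftAccepted → Stage (suc m)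
    changed-type changed = record
      { base         = 8 ℕ.+ b
      ; arrangement  = arrangement₂
      ; chain        = chain₂
      ; leftAccepted = not leftAccepted
      ; bound        = bound₂
      ; size         = ℕ.≤-trans size-suc (ℕ.m≤n+m (4 ℕ.+ n) 2)
      }
      where
      σ₂ : Arrivals (6 ℕ.+ n)
      σ₂ = interval (6 ℕ.+ b) ∷ interval (4 ℕ.+ b) ∷ τ

      arrangement₂ : Arrangement σ₂ (10 ℕ.+ b ∷ 8 ℕ.+ b ∷ 6 ℕ.+ b ∷ 4 ℕ.+ b ∷ 2 ℕ.+ b ∷ b ∷ rest)
      arrangement₂ = arrange-third (6 ℕ.+ b) (arrange-third (4 ℕ.+ b) τ-arrangement)

      chain₂ : Chain (10 ℕ.+ b ∷ 8 ℕ.+ b ∷ 6 ℕ.+ b ∷ 4 ℕ.+ b ∷ 2 ℕ.+ b ∷ b ∷ rest)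
      chain₂ = shifted-cons 10 8 6 b (shifted-cons 8 6 4 b (shifted-cons 6 4 2 b (shifted-cons 4 2 0 b chain)))

      ok : FeasibleThroughout σ₂
      ok = feasible (chain-input arrangement₂ chain₂)

      bound₂ : ∀ S → S ⊆ selected σ₂ →
        8 ℕ.* ∣ S ∣ ℕ.≤ 3 ℕ.* (6 ℕ.+ n) ℕ.+ penalty (not leftAccepted) (bit (lookup S (suc (suc zero))))
      bound₂ (x ∷ y ∷ p ∷ q ∷ S) S⊆ = begin
        8 ℕ.* ∣ x ∷ y ∷ p ∷ q ∷ S ∣
          ≡⟨ cong (8 ℕ.*_) count ⟩
        8 ℕ.* ((bit x ℕ.+ (bit y ℕ.+ (bit p ℕ.+ bit q))) ℕ.+ ∣ S ∣)
          ≤⟨ add-cost {∣ S ∣} {3 ℕ.* (2 ℕ.+ n)} {bit x ℕ.+ (bit y ℕ.+ (bit p ℕ.+ bit q))}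
                 (bound S (restrict (restrict (restrict (restrict S⊆)))))
               (changed-type-cost leftAccepted
                 (at-most-one σ₂ S-ok {suc zero} {suc (suc (suc (suc leftmost)))} (λ ())
                   (subst (Overlap (interval (4 ℕ.+ b))) (sym (sorted arrangement zero))
                     (shifted-overlap 4 2 b)))
                 (at-most-one σ₂ S-ok {zero} {suc zero} (λ ()) (shifted-overlap 6 4 b))
                 (at-most-one σ₂ S-ok {suc (suc (suc zero))} {zero} (λ ()) (shifted-overlap 8 6 b))
                 (subst (λ t → Lost t (bit p) (bit q)) changed
                   (lost (proj₁ (proj₂ (proj₂ ok))) (shifted-overlap 10 8 b) (restrict (restrict S⊆))))) ⟩
        3 ℕ.* (2 ℕ.+ n) ℕ.+ (12 ℕ.+ penalty (not leftAccepted) (bit p))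
          ≡⟨ solve 2 (λ n k → con 3 :* (con 2 :+ n) :+ (con 12 :+ k) := con 3 :* (con 6 :+ n) :+ k)
               refl n (penalty (not leftAccepted) (bit p)) ⟩
        3 ℕ.* (6 ℕ.+ n) ℕ.+ penalty (not leftAccepted) (bit p) ∎
        where
        open ℕ.≤-Reasoning
        open ℕ-Solver
        S-ok : NonOverlapping σ₂ (x ∷ y ∷ p ∷ q ∷ S)
        S-ok = subset-NonOverlapping (proj₁ ok) S⊆
        count : ∣ x ∷ y ∷ p ∷ q ∷ S ∣ ≡ (bit x ℕ.+ (bit y ℕ.+ (bit p ℕ.+ bit q))) ℕ.+ ∣ S ∣
        count rewrite ∣∷∣ x (y ∷ p ∷ q ∷ S) | ∣∷∣ y (p ∷ q ∷ S) | ∣∷∣ p (q ∷ S) | ∣∷∣ q S =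
          solve 5 (λ x y p q s → x :+ (y :+ (p :+ (q :+ s))) := (x :+ (y :+ (p :+ q))) :+ s)
            refl (bit x) (bit y) (bit p) (bit q) ∣ S ∣

    next-stage : Stage (suc m)
    next-stage with accept τ Bool.≟ leftAccepted
    ... | yes same   = same-type same
    ... | no changed = changed-type (Bool.¬-not changed)

  stage : ∀ m → Stage m
  stage zero    = first-stage
  stage (suc m) = NextStage.next-stage (stage m)

  ALG-bound : ∀ {m} (s : Stage m) → 8 ℕ.* ALG alg (Stage.σ s) ℕ.≤ 3 ℕ.* (2 ℕ.+ Stage.n s) ℕ.+ 8
  ALG-bound s = ℕ.≤-trans (bound (selected σ) (λ i∈ → i∈))
    (ℕ.+-monoʳ-≤ (3 ℕ.* (2 ℕ.+ n)) (penalty≤8 leftAccepted _))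
    where
    open Stage s
    penalty≤8 : ∀ t p → penalty t (bit p) ℕ.≤ 8
    penalty≤8 true  p = ℕ.*-monoʳ-≤ 8 (bit≤1 p)
    penalty≤8 false p = ℕ.m≤m+n 4 4

  -- The optimum is at least half the number of intervals, which turns 3/8 of that number into 3/4
  -- of the optimum.
  ALG-OPT : ∀ {m opt} (s : Stage m) → IsOPT (Stage.σ s) opt →
            m ℕ.≤ opt × 4 ℕ.* ALG alg (Stage.σ s) ℕ.≤ 3 ℕ.* opt ℕ.+ 4
  ALG-OPT {m} {opt} s (_ , maximal) =
    ℕ.*-cancelˡ-≤ 2 (ℕ.≤-trans size n≤2opt) ,
    ℕ.*-cancelˡ-≤ 2 (begin
      2 ℕ.* (4 ℕ.* a)             ≡⟨ ℕ.*-assoc 2 4 a ⟨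
      8 ℕ.* a                     ≤⟨ ALG-bound s ⟩
      3 ℕ.* (2 ℕ.+ n) ℕ.+ 8       ≤⟨ ℕ.+-monoˡ-≤ 8 (ℕ.*-monoʳ-≤ 3 n≤2opt) ⟩
      3 ℕ.* (2 ℕ.* opt) ℕ.+ 8     ≡⟨ solve 1 (λ o → con 3 :* (con 2 :* o) :+ con 8 :=
                                                    con 2 :* (con 3 :* o :+ con 4)) refl opt ⟩
      2 ℕ.* (3 ℕ.* opt ℕ.+ 4)     ∎)
    where
    open Stage s
    open ℕ.≤-Reasoning
    open ℕ-Solver
    a = ALG alg σ
    n≤2opt : 2 ℕ.+ n ℕ.≤ 2 ℕ.* opt
    n≤2opt with half-NonOverlapping σ input
    ... | S , S-ok , n≤2S = ℕ.≤-trans n≤2S (ℕ.*-monoʳ-≤ 2 (maximal S S-ok))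

-- Natural numbers among the rationals and the Archimedean property.

nat : ℕ → ℚ
nat n = + n / 1

-- Normalisation by a gcd blocks computation with a variable numerator, so the arithmetic of `nat`
-- is done on unnormalised rationals.
toℚᵘ-nat : ∀ n → ℚ.toℚᵘ (nat n) ℚᵘ.≃ ℚᵘ.mkℚᵘ (+ n) 0
toℚᵘ-nat n = ℚ.toℚᵘ-fromℚᵘ (ℚᵘ.mkℚᵘ (+ n) 0)

nat-mono : ∀ {m n} → m ℕ.≤ n → nat m ℚ.≤ nat n
nat-mono {m} {n} m≤n = ℚ.toℚᵘ-cancel-≤ (begin
  ℚ.toℚᵘ (nat m)      ≃⟨ toℚᵘ-nat m ⟩
  ℚᵘ.mkℚᵘ (+ m) 0     ≤⟨ ℚᵘ.*≤* (ℤ.*-monoʳ-≤-nonNeg (+ 1) (ℤ.+≤+ m≤n)) ⟩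
  ℚᵘ.mkℚᵘ (+ n) 0     ≃⟨ toℚᵘ-nat n ⟨
  ℚ.toℚᵘ (nat n)      ∎)
  where open ℚᵘ.≤-Reasoning

nat-+ : ∀ m n → nat (m ℕ.+ n) ≡ nat m ℚ.+ nat n
nat-+ m n = ℚ.toℚᵘ-injective (begin-equality
  ℚ.toℚᵘ (nat (m ℕ.+ n))
    ≃⟨ toℚᵘ-nat (m ℕ.+ n) ⟩
  ℚᵘ.mkℚᵘ (+ (m ℕ.+ n)) 0
    ≃⟨ ℚᵘ.*≡* (cong (ℤ._* + 1) (sym (cong₂ ℤ._+_ (ℤ.*-identityʳ (+ m)) (ℤ.*-identityʳ (+ n))))) ⟩
  ℚᵘ.mkℚᵘ (+ m) 0 ℚᵘ.+ ℚᵘ.mkℚᵘ (+ n) 0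
    ≃⟨ ℚᵘ.+-cong (toℚᵘ-nat m) (toℚᵘ-nat n) ⟨
  ℚ.toℚᵘ (nat m) ℚᵘ.+ ℚ.toℚᵘ (nat n)
    ≃⟨ ℚ.toℚᵘ-homo-+ (nat m) (nat n) ⟨
  ℚ.toℚᵘ (nat m ℚ.+ nat n) ∎)
  where open ℚᵘ.≤-Reasoning

nat-* : ∀ m n → nat (m ℕ.* n) ≡ nat m ℚ.* nat n
nat-* zero    n = sym (ℚ.*-zeroˡ (nat n))
nat-* (suc m) n = begin
  nat (n ℕ.+ m ℕ.* n)         ≡⟨ nat-+ n (m ℕ.* n) ⟩
  nat n ℚ.+ nat (m ℕ.* n)     ≡⟨ cong (nat n ℚ.+_) (nat-* m n) ⟩
  nat n ℚ.+ nat m ℚ.* nat n   ≡⟨ solve 2 (λ m n → n :+ m :* n := (con 1ℚ :+ m) :* n) refl (nat m) (nat n) ⟩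
  (1ℚ ℚ.+ nat m) ℚ.* nat n    ≡⟨ cong (ℚ._* nat n) (nat-+ 1 m) ⟨
  nat (suc m) ℚ.* nat n       ∎
  where open ≡-Reasoning; open ℚ-Solver

-- The denominator is at least one, so the absolute value of the numerator is an upper bound.
≤-nat : ∀ p → ∃[ n ] p ℚ.≤ nat n
≤-nat p = ℤ.∣ ℚ.↥ p ∣ , ℚ.toℚᵘ-cancel-≤
  (ℚᵘ.≤-trans (ℚᵘ.*≤* (bound p)) (ℚᵘ.≤-reflexive (ℚᵘ.≃-sym (toℚᵘ-nat ℤ.∣ ℚ.↥ p ∣))))
  where
  bound : ∀ p → ℚᵘ.↥ (ℚ.toℚᵘ p) ℤ.* + 1 ℤ.≤ + ℤ.∣ ℚ.↥ p ∣ ℤ.* ℚᵘ.↧ (ℚ.toℚᵘ p)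
  bound (ℚ.mkℚ (+ n)        d _) = ℤ.*-monoˡ-≤-nonNeg (+ n) (ℤ.+≤+ (s≤s z≤n))
  bound (ℚ.mkℚ (ℤ.-[1+ n ]) d _) = ℤ.-≤+

archimedean : ∀ c ε → 0ℚ ℚ.< ε → ∃[ n ] c ℚ.≤ ε ℚ.* nat n
archimedean c ε 0<ε = n , (begin
  c                       ≡⟨ ℚ.*-identityʳ c ⟨
  c ℚ.* 1ℚ                ≡⟨ cong (c ℚ.*_) (ℚ.*-inverseʳ ε) ⟨
  c ℚ.* (ε ℚ.* ℚ.1/ ε)    ≡⟨ solve 3 (λ c e i → c :* (e :* i) := e :* (c :* i)) refl c ε (ℚ.1/ ε) ⟩
  ε ℚ.* (c ℚ.* ℚ.1/ ε)    ≤⟨ ℚ.*-monoˡ-≤-nonNeg ε {{ℚ.pos⇒nonNeg ε}} (proj₂ (≤-nat (c ℚ.* ℚ.1/ ε))) ⟩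
  ε ℚ.* nat n             ∎)
  where
  open ℚ.≤-Reasoning
  open ℚ-Solver
  instance
    ε-pos : ℚ.Positive ε
    ε-pos = ℚ.positive 0<ε
    ε-nonZero : ℚ.NonZero ε
    ε-nonZero = ℚ.pos⇒nonZero ε
  n = proj₁ (≤-nat (c ℚ.* ℚ.1/ ε))

∣p-q∣<r⇒p≤q+r : ∀ p q r → ℚ.∣ p ℚ.- q ∣ ℚ.< r → p ℚ.≤ q ℚ.+ r
∣p-q∣<r⇒p≤q+r p q r p-q<r = begin
  p                    ≡⟨ solve 2 (λ p q → p := q :+ (p :- q)) refl p q ⟩
  q ℚ.+ (p ℚ.- q)      ≤⟨ ℚ.+-monoʳ-≤ q (ℚ.≤-trans (d≤∣d∣ (p ℚ.- q)) (ℚ.<⇒≤ p-q<r)) ⟩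
  q ℚ.+ r              ∎
  where
  open ℚ.≤-Reasoning
  open ℚ-Solver
  d≤∣d∣ : ∀ d → d ℚ.≤ ℚ.∣ d ∣
  d≤∣d∣ d with ℚ.≤-total 0ℚ d
  ... | inj₁ 0≤d = ℚ.≤-reflexive (sym (ℚ.0≤p⇒∣p∣≡p 0≤d))
  ... | inj₂ d≤0 = ℚ.≤-trans d≤0 (ℚ.0≤∣p∣ d)

nat-ratio : ∀ a o → 4 ℕ.* a ℕ.≤ 3 ℕ.* o ℕ.+ 4 → nat a ℚ.≤ (+ 3 / 4) ℚ.* nat o ℚ.+ 1ℚ
nat-ratio a o 4a≤3o+4 = ℚ.*-cancelˡ-≤-pos (nat 4) (begin
  nat 4 ℚ.* nat a                              ≡⟨ nat-* 4 a ⟨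
  nat (4 ℕ.* a)                                ≤⟨ nat-mono 4a≤3o+4 ⟩
  nat (3 ℕ.* o ℕ.+ 4)                          ≡⟨ nat-+ (3 ℕ.* o) 4 ⟩
  nat (3 ℕ.* o) ℚ.+ nat 4                      ≡⟨ cong (ℚ._+ nat 4) (nat-* 3 o) ⟩
  nat 3 ℚ.* nat o ℚ.+ nat 4                    ≡⟨ solve 1 (λ o → con (nat 3) :* o :+ con (nat 4) :=
                                                    con (nat 4) :* (con (+ 3 / 4) :* o :+ con 1ℚ)) refl (nat o) ⟩
  nat 4 ℚ.* ((+ 3 / 4) ℚ.* nat o ℚ.+ 1ℚ)       ∎)
  where open ℚ.≤-Reasoning; open ℚ-Solver

-- The asymptotic ratio.

theorem10 : (alg : Algorithm) (ρ b : ℝ) →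
    (∀ (n : ℕ) (σ : Arrivals n) (opt : ℕ) → ChainInput σ → IsOPT σ opt →
    ρ * fromℕ opt - b ≤ fromℕ (ALG alg σ)) →
    ρ ≤ fromℚ (+ 3 / 4)
-- As `_≤_` is a negation, the last argument is a gap `ε` by which `ρ` exceeds 3/4 from index `N`
-- on. The goal is `⊥`, so a doubly negated optimum suffices.
theorem10 alg ρ b competitive (ε , 0<ε , N , ρ-large) =
  let S , S-ok , _ = half-NonOverlapping σ input
  in ¬¬-optimum σ S S-ok λ (opt , isOPT) → competitive _ σ opt input isOPT (below opt isOPT)
  where
  M = proj₁ (cauchy b 1ℚ (ℚ.positive⁻¹ 1ℚ))

  -- A rational upper bound for the tail of `b`, from the Cauchy condition with tolerance one.
  B = seq b M ℚ.+ 1ℚ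

  b≤B : ∀ n → M ℕ.≤ n → seq b n ℚ.≤ B
  b≤B n M≤n = ∣p-q∣<r⇒p≤q+r (seq b n) (seq b M) 1ℚ
    (proj₂ (cauchy b 1ℚ (ℚ.positive⁻¹ 1ℚ)) n M M≤n ℕ.≤-refl)

  -- Chosen so that `ε * K` absorbs `B`, the additive 1 of `nat-ratio` and the margin 1 that makes
  -- the inequality strict; the optimum at stage `K` is at least `K`.
  K = proj₁ (archimedean (B ℚ.+ nat 2) ε 0<ε)

  open Adversary alg
  open Stage (stage K) using (σ; input)

  a = ALG alg σ

  below : ∀ opt → IsOPT σ opt → fromℕ a < ρ * fromℕ opt - b
  below opt isOPT = 1ℚ , ℚ.positive⁻¹ 1ℚ , N ℕ.⊔ M , λ n N⊔M≤n → begin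
    nat a ℚ.+ 1ℚ
      ≤⟨ ℚ.+-monoˡ-≤ 1ℚ (nat-ratio a opt (proj₂ (ALG-OPT (stage K) isOPT))) ⟩
    (+ 3 / 4) ℚ.* o ℚ.+ 1ℚ ℚ.+ 1ℚ
      ≡⟨ solve 2 (λ o B → con (+ 3 / 4) :* o :+ con 1ℚ :+ con 1ℚ :=
                          con (+ 3 / 4) :* o :+ (B :+ con (nat 2)) :- B) refl o B ⟩
    (+ 3 / 4) ℚ.* o ℚ.+ (B ℚ.+ nat 2) ℚ.- B
      ≤⟨ ℚ.+-mono-≤ (ℚ.+-monoʳ-≤ ((+ 3 / 4) ℚ.* o) B+2≤εo)
           (ℚ.neg-antimono-≤ (b≤B n (ℕ.m⊔n≤o⇒n≤o N M N⊔M≤n))) ⟩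
    (+ 3 / 4) ℚ.* o ℚ.+ ε ℚ.* o ℚ.- seq b n
      ≡⟨ cong (ℚ._- seq b n) (ℚ.*-distribʳ-+ o (+ 3 / 4) ε) ⟨
    (+ 3 / 4 ℚ.+ ε) ℚ.* o ℚ.- seq b n
      ≤⟨ ℚ.+-monoˡ-≤ (ℚ.- seq b n)
           (ℚ.*-monoʳ-≤-nonNeg o {{ℚ.nonNegative (nat-mono {0} {opt} z≤n)}} (ρ-large n (ℕ.m⊔n≤o⇒m≤o N M N⊔M≤n))) ⟩
    seq ρ n ℚ.* o ℚ.- seq b n ∎
    where
    open ℚ.≤-Reasoning
    open ℚ-Solver
    o = nat opt
    B+2≤εo : B ℚ.+ nat 2 ℚ.≤ ε ℚ.* o
    B+2≤εo = ℚ.≤-trans (proj₂ (archimedean (B ℚ.+ nat 2) ε 0<ε))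
      (ℚ.*-monoˡ-≤-nonNeg ε {{ℚ.nonNegative (ℚ.<⇒≤ 0<ε)}} (nat-mono {K} {opt} (proj₁ (ALG-OPT (stage K) isOPT))))
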